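{- Let $\mu$ be an infinite cardinal, $\langle\mathbb{Q}_i:i\in I\rangle$ a sequence of posets such that each $\mathbb{Q}_i=\bigcup_{\zeta<\mu}Q_{i,\zeta}$ with each $Q_{i,\zeta}$ an $\mathrm{Fr}$-linked subset of $\mathbb{Q}_i$, and let $\mathbb{P}$ be the finite support product of $\langle\mathbb{Q}_i:i\in I\rangle$. Assume (i) $|I|\leq 2^\mu$, and (ii) for every finite $u\subseteq I$ and every $s:u\to\mu$, $\prod_{i\in u}Q_{i,s(i)}$ is $\mathrm{Fr}$-linked in $\prod_{i\in u}\mathbb{Q}_i$. Then $\mathbb{P}$ is $\mu$-$\mathrm{Fr}$-linked.
   Context: For a poset $\mathbb{P}$ and $\bar p=\langle p_n:n<\omega\rangle$ in $\mathbb{P}$, $\dot W(\bar p)$ names $\{n:p_n\in\dot G\}$. $Q\subseteq\mathbb{P}$ is $\mathrm{Fr}$-linked if for every sequence $\bar p$ in $Q$ some $q\in\mathbb{P}$ forces $\dot W(\bar p)$ infinite. $\mathbb{P}$ is $\mu$-$\mathrm{Fr}$-linked if it is a union of $\mu$ many $\mathrm{Fr}$-linked subsets. -}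

module Defs where

open import Data.Empty using (⊥)
open import Data.Fin.Base using (Fin)
open import Data.Fin.Patterns using (0F; 1F; 2F)
open import Data.List.Base using (List)
open import Data.List.Membership.Propositional using () renaming (_∈_ to _∈ᴸ_)
open import Data.List.Relation.Unary.Unique.Propositional using (Unique)
open import Data.Maybe.Base using (Maybe; maybe)
open import Data.Nat.Base using (ℕ; zero; suc)
open import Data.Product.Base using (Σ-syntax; ∃-syntax; _×_; _,_; proj₁; proj₂)
open import Data.Vec.Base using (Vec; []; _∷_; lookup)
open import Level using (Level; Lift; lower) renaming (suc to lsuc)
open import Relation.Binary.Bundles using (Poset)
open import Relation.Binary.Construct.Interior.Symmetric using () renaming (poset to symPoset)
open import Relation.Nullary.Negation.Core using (¬_)
open import Relation.Unary using (Pred; _∈_)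

private
  variable
    ℓ : Level

infix  8 _∈̇_ _≐_
infixr 7 _∧̇_
infixr 6 _⇒̇_

-- First-order formulas of set theory with n free variables (de Bruijn indices).
data Formula : ℕ → Set where
  _∈̇_ : ∀ {n} → Fin n → Fin n → Formula n
  _≐_ : ∀ {n} → Fin n → Fin n → Formula n
  ¬̇_  : ∀ {n} → Formula n → Formula n
  _∧̇_ : ∀ {n} → Formula n → Formula n → Formula n
  ∀̇_  : ∀ {n} → Formula (suc n) → Formula n

_⇒̇_ : ∀ {n} → Formula n → Formula n → Formula n
φ ⇒̇ ψ = ¬̇ (φ ∧̇ (¬̇ ψ))

∃̇_ : ∀ {n} → Formula (suc n) → Formula n
∃̇ φ = ¬̇ (∀̇ (¬̇ φ))

-- Variable 0 is a subset W of ω and variable 1 is ω: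
-- "for every m ∈ ω there is n ∈ W with m ∈ n", where m ∈ n is m < n.
infinite : Formula 2
infinite = ∀̇ (0F ∈̇ 2F ⇒̇ (∃̇ (0F ∈̇ 2F ∧̇ 1F ∈̇ 0F)))

-- Well-founded sets of the ground model.
data V (ℓ : Level) : Set (lsuc ℓ) where
  set : (A : Set ℓ) → (A → V ℓ) → V ℓ

-- x ∪ {x}
succ : V ℓ → V ℓ
succ x@(set A f) = set (Maybe A) (maybe f x)

numeral : ℕ → V ℓ
numeral {ℓ} zero    = set (Lift ℓ ⊥) λ ()
numeral     (suc n) = succ (numeral n)

ω : V ℓ
ω {ℓ} = set (Lift ℓ ℕ) λ n → numeral (lower n)

-- Stronger conditions are smaller.
module Forcing {ℓ} (P : Poset ℓ ℓ ℓ) where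
  open Poset P using (_≤_) renaming (Carrier to ℙ)

  -- name A τ s is the ℙ-name {(τ a , s a) : a ∈ A}.
  data Name : Set (lsuc ℓ) where
    name : (A : Set ℓ) → (A → Name) → (A → ℙ) → Name

  -- As ℙ need not have a largest element, x̌ = {(y̌ , p) : y ∈ x , p ∈ ℙ}.
  check : V ℓ → Name
  check (set A f) = name (A × ℙ) (λ a → check (f (proj₁ a))) proj₂

  DenseBelow : ℙ → Pred ℙ ℓ → Set ℓ
  DenseBelow p D = ∀ q → q ≤ p → ∃[ r ] (r ≤ q × D r)

  infix 4 _⊩_≈_ _⊩_ε_ _⊩_[_]

  -- The two conjuncts force σ ⊆ τ and τ ⊆ σ; the forcing clause for
  -- membership (_⊩_ε_ below) is unfolded in them.
  _⊩_≈_ : ℙ → Name → Name → Set ℓ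
  p ⊩ name A σ s ≈ name B τ t =
    (∀ a q → q ≤ p → q ≤ s a →
       DenseBelow q λ r → ∃[ b ] (r ≤ t b × r ⊩ σ a ≈ τ b)) ×
    (∀ b q → q ≤ p → q ≤ t b →
       DenseBelow q λ r → ∃[ a ] (r ≤ s a × r ⊩ σ a ≈ τ b))

  _⊩_ε_ : ℙ → Name → Name → Set ℓ
  p ⊩ σ ε name B τ t =
    DenseBelow p λ r → ∃[ b ] (r ≤ t b × r ⊩ σ ≈ τ b)

  _⊩_[_] : ∀ {n} → ℙ → Formula n → Vec Name n → Set (lsuc ℓ)
  p ⊩ x ∈̇ y [ ρ ] = Lift (lsuc ℓ) (p ⊩ lookup ρ x ε lookup ρ y)
  p ⊩ x ≐ y [ ρ ] = Lift (lsuc ℓ) (p ⊩ lookup ρ x ≈ lookup ρ y)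
  p ⊩ ¬̇ φ   [ ρ ] = ∀ q → q ≤ p → ¬ (q ⊩ φ [ ρ ])
  p ⊩ φ ∧̇ ψ [ ρ ] = (p ⊩ φ [ ρ ]) × (p ⊩ ψ [ ρ ])
  p ⊩ ∀̇ φ   [ ρ ] = ∀ τ → p ⊩ φ [ τ ∷ ρ ]

  -- {(ň , p̄ n) : n < ω}, a name of {n : p̄ n ∈ Ġ}
  Ẇ : (ℕ → ℙ) → Name
  Ẇ p̄ = name (Lift ℓ ℕ) (λ n → check (numeral (lower n))) (λ n → p̄ (lower n))

  FrLinked : Pred ℙ ℓ → Set (lsuc ℓ)
  FrLinked Q = (p̄ : ℕ → ℙ) → (∀ n → p̄ n ∈ Q) →
               ∃[ q ] (q ⊩ infinite [ Ẇ p̄ ∷ check ω ∷ [] ])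

open Forcing public using (FrLinked)

-- ℙ = ⋃ { S ζ : ζ ∈ M }
Covers : (P : Poset ℓ ℓ ℓ) {M : Set ℓ} → (M → Pred (Poset.Carrier P) ℓ) → Set ℓ
Covers P S = ∀ p → ∃[ ζ ] p ∈ S ζ

-- μ-Fr-linked, for μ the cardinality of M
_-FrLinked_ : Set ℓ → Poset ℓ ℓ ℓ → Set (lsuc ℓ)
_-FrLinked_ {ℓ} M P =
  Σ[ S ∈ (M → Pred (Poset.Carrier P) ℓ) ]
    (Covers P S × (∀ ζ → FrLinked P (S ζ)))

-- Finite subsets as repetition-free lists; uniqueness makes i ∈ᴸ list u
-- proof-irrelevant, so functions on u may be curried over membership proofs.
record FinSubset (I : Set ℓ) : Set ℓ where
  field
    list   : List I
    unique : Unique list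

open FinSubset public

infix 4 _∈ᶠ_

_∈ᶠ_ : {I : Set ℓ} → I → FinSubset I → Set ℓ
i ∈ᶠ u = i ∈ᴸ list u

module _ {I : Set ℓ} (Q : I → Poset ℓ ℓ ℓ) where
  private
    module Q (i : I) = Poset (Q i)

  Π : FinSubset I → Set ℓ
  Π u = ∀ i → i ∈ᶠ u → Q.Carrier i

  finiteProduct : FinSubset I → Poset ℓ ℓ ℓ
  finiteProduct u = record
    { Carrier = Π u
    ; _≈_     = λ p q → ∀ i i∈u → Q._≈_ i (p i i∈u) (q i i∈u)
    ; _≤_     = λ p q → ∀ i i∈u → Q._≤_ i (p i i∈u) (q i i∈u)
    ; isPartialOrder = record
      { isPreorder = record
        { isEquivalence = record
          { refl  = λ i _ → Q.Eq.refl i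
          ; sym   = λ p≈q i i∈u → Q.Eq.sym i (p≈q i i∈u)
          ; trans = λ p≈q q≈r i i∈u → Q.Eq.trans i (p≈q i i∈u) (q≈r i i∈u)
          }
        ; reflexive = λ p≈q i i∈u → Q.reflexive i (p≈q i i∈u)
        ; trans     = λ p≤q q≤r i i∈u → Q.trans i (p≤q i i∈u) (q≤r i i∈u)
        }
      ; antisym = λ p≤q q≤p i i∈u → Q.antisym i (p≤q i i∈u) (q≤p i i∈u)
      }
    }

  -- Finite partial functions p on I with p(i) ∈ ℚᵢ for i ∈ dom p.
  record Condition : Set ℓ where
    field
      dom : FinSubset I
      val : Π dom

  open Condition

  _≼_ : Condition → Condition → Set ℓ
  p ≼ q = ∀ i (i∈q : i ∈ᶠ dom q) →
          Σ[ i∈p ∈ i ∈ᶠ dom p ] Q._≤_ i (val p i i∈p) (val q i i∈q)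

  -- Its equality p ≼ q × q ≼ p says that p and q have the same elements in
  -- their domains and, each ℚᵢ being antisymmetric, equal values on them.
  finiteSupportProduct : Poset ℓ ℓ ℓ
  finiteSupportProduct = symPoset {R = _≼_} (λ {p} → ≼-refl {p}) (λ {p q r} → ≼-trans {p} {q} {r})
    where
    ≼-refl : ∀ {p} → p ≼ p
    ≼-refl i i∈p = i∈p , Q.refl i

    ≼-trans : ∀ {p q r} → p ≼ q → q ≼ r → p ≼ r
    ≼-trans p≼q q≼r i i∈r =
      let i∈q , q≤r = q≼r i i∈r
          i∈p , p≤q = p≼q i i∈q
      in  i∈p , Q.trans i p≤q q≤r

  -- ∏_{i∈u} S i (s i)
  boxProduct : {M : Set ℓ} → (∀ i → M → Pred (Q.Carrier i) ℓ) →
               (u : FinSubset I) → (∀ i → i ∈ᶠ u → M) → Pred (Π u) ℓ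
  boxProduct S u s p = ∀ i (i∈u : i ∈ᶠ u) → p i i∈u ∈ S i (s i i∈u)

{-# OPTIONS --safe #-}

-- As equality of names is an equivalence relation and numerals are absolute,
-- q forces Ẇ(p̄) to be infinite iff for every m the conditions lying below
-- some p̄ n with n > m are dense below q.
--
-- As |I| ≤ 2^μ, the points of I are distinguished by μ many bits, so finite
-- decision trees with leaves in μ give μ many functions h : I → μ among which
-- every finite partial function has an extension (Engelking–Karłowicz); that
-- there are only μ many trees uses μ · μ = μ.  The piece indexed by (h , n)
-- consists of the conditions p with |dom p| = n and p(i) ∈ Q_{i,h(i)} for all
-- i ∈ dom p.  Given a sequence in such a piece, pass to a subsequence whose
-- domains all contain a finite root u and contain each other point only
-- finitely often.  Hypothesis (ii) yields q ∈ ∏_{i∈u} ℚᵢ for the restrictions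
-- to u.  A condition r ≤ q is amalgamated with p̄ n for suitable n: outside u
-- the domains of r and p̄ n are disjoint once n is large.

module Submission where

open import Defs
open import Axiom.ExcludedMiddle using (ExcludedMiddle)
open import Axiom.Extensionality.Propositional using (Extensionality)
open import Data.Bool.Base using (Bool; true; false; T; if_then_else_)
open import Data.Bool.Properties using (T-irrelevant)
open import Data.Empty using (⊥-elim)
open import Data.List.Base using (List; []; _∷_; _++_; length; deduplicate)
open import Data.List.Membership.Propositional using (_∈_; _∉_)
open import Data.List.Membership.Propositional.Properties using (∈-∃++; ∈-++⁺ˡ; ∈-++⁺ʳ; ∈-++⁻; ∈-deduplicate⁺; ∈-deduplicate⁻)
open import Data.List.Membership.Propositional.Properties.WithK using (unique⇒irrelevant)
open import Data.List.Properties using (length-++)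
open import Data.List.Relation.Unary.All using (lookup)
open import Data.List.Relation.Unary.All.Properties using (¬Any⇒All¬; All¬⇒¬Any)
open import Data.List.Relation.Unary.AllPairs using ([]; _∷_)
open import Data.List.Relation.Unary.Any using (here; there)
open import Data.List.Relation.Unary.Unique.DecPropositional.Properties using (deduplicate-!)
open import Data.List.Relation.Unary.Unique.Propositional using (Unique)
open import Data.Maybe.Base using (just; nothing)
open import Data.Nat.Base using (ℕ; zero; suc; _<_; s≤s⁻¹; _+_; _*_; _≤_; _⊔_; z≤n; s≤s)
open import Data.Nat.Induction using (<-rec)
open import Data.Nat.Properties using (≤-refl; <-irrefl; <-cmp; m≤n⇒m<n∨m≡n; m<n⇒m<1+n; n<1+n; suc-injective; *-cancelˡ-≡; even≢odd; ≤-trans; ≤-reflexive; <⇒≤; <-≤-trans; m≤m⊔n; m≤n⊔m; +-suc; m≤m+n)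
open import Data.Product.Base using (∃-syntax; Σ-syntax; _×_; _,_; proj₁; proj₂; uncurry)
open import Data.Product.Properties using (,-injective; ,-injectiveʳ)
open import Data.Sum.Base using (_⊎_; inj₁; inj₂; [_,_])
open import Data.Sum.Properties using (inj₁-injective; inj₂-injective)
open import Data.Vec.Base using ([]; _∷_)
open import Function.Base using (_∘_)
open import Function.Bundles using (_↣_; mk↣; Injection)
open import Level using (Level; lift)
open import Relation.Binary.Bundles using (Poset)
open import Relation.Binary.Definitions using (tri<; tri≈; tri>)
open import Relation.Binary.PropositionalEquality using (_≡_; refl; sym; cong; trans; cong₂; subst)
open import Relation.Nullary.Decidable using (yes; no; decidable-stable; ⌊_⌋; toWitness; fromWitness)
open import Relation.Nullary.Negation using (¬_)
open import Relation.Unary using (Pred)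

private
  variable
    a b ℓ : Level
    A : Set a

-- Membership in ground-model sets and in numerals.

infix 4 _∈ⱽ_

_∈ⱽ_ : V ℓ → V ℓ → Set _
x ∈ⱽ set A f = ∃[ a ] f a ≡ x

∈-succ⁺ : ∀ {x y : V ℓ} → x ∈ⱽ y ⊎ x ≡ y → x ∈ⱽ succ y
∈-succ⁺ {y = set A f} (inj₁ (a , eq)) = just a , eq
∈-succ⁺ {y = set A f} (inj₂ refl)     = nothing , refl

∈-succ⁻ : ∀ {x y : V ℓ} → x ∈ⱽ succ y → x ∈ⱽ y ⊎ x ≡ y
∈-succ⁻ {y = set A f} (just a , eq)    = inj₁ (a , eq)
∈-succ⁻ {y = set A f} (nothing , refl) = inj₂ refl

∈-numeral⁺ : ∀ {m n} → m < n → numeral {ℓ} m ∈ⱽ numeral n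
∈-numeral⁺ {n = suc n} m<1+n with m≤n⇒m<n∨m≡n (s≤s⁻¹ m<1+n)
... | inj₁ m<n  = ∈-succ⁺ (inj₁ (∈-numeral⁺ m<n))
... | inj₂ refl = ∈-succ⁺ {y = numeral n} (inj₂ refl)

∈-numeral⁻ : ∀ n {x : V ℓ} → x ∈ⱽ numeral n → ∃[ m ] (m < n × x ≡ numeral m)
∈-numeral⁻ (suc n) x∈ with ∈-succ⁻ {y = numeral n} x∈
... | inj₁ x∈n = let m , m<n , eq = ∈-numeral⁻ n x∈n in m , m<n⇒m<1+n m<n , eq
... | inj₂ eq  = n , n<1+n n , eq

-- Forced equality and membership, and names of infinite sets.

module ForcingProperties (P : Poset ℓ ℓ ℓ) where
  open Poset P using () renaming (Carrier to ℙ; _≤_ to _≤ᴾ_; refl to ≤ᴾ-refl; trans to ≤ᴾ-trans)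
  open Forcing P

  ≈-mono : ∀ {p q} σ τ → q ≤ᴾ p → p ⊩ σ ≈ τ → q ⊩ σ ≈ τ
  ≈-mono (name _ _ _) (name _ _ _) q≤p (σ⊆τ , τ⊆σ) =
    (λ a r r≤q → σ⊆τ a r (≤ᴾ-trans r≤q q≤p)) ,
    (λ b r r≤q → τ⊆σ b r (≤ᴾ-trans r≤q q≤p))

  ≈-refl : ∀ {p} σ → p ⊩ σ ≈ σ
  ≈-refl (name A σ s) =
    (λ a q _ q≤s r r≤q → r , ≤ᴾ-refl , a , ≤ᴾ-trans r≤q q≤s , ≈-refl (σ a)) ,
    (λ a q _ q≤s r r≤q → r , ≤ᴾ-refl , a , ≤ᴾ-trans r≤q q≤s , ≈-refl (σ a))

  ≈-sym : ∀ {p} σ τ → p ⊩ σ ≈ τ → p ⊩ τ ≈ σ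
  ≈-sym (name A σ s) (name B τ t) (σ⊆τ , τ⊆σ) =
    (λ b q q≤p q≤t r r≤q →
      let r′ , r′≤r , a , r′≤s , eq = τ⊆σ b q q≤p q≤t r r≤q
      in  r′ , r′≤r , a , r′≤s , ≈-sym (σ a) (τ b) eq) ,
    (λ a q q≤p q≤s r r≤q →
      let r′ , r′≤r , b , r′≤t , eq = σ⊆τ a q q≤p q≤s r r≤q
      in  r′ , r′≤r , b , r′≤t , ≈-sym (σ a) (τ b) eq)

  ≈-trans : ∀ {p} σ τ υ → p ⊩ σ ≈ τ → p ⊩ τ ≈ υ → p ⊩ σ ≈ υ
  ≈-trans (name A σ s) (name B τ t) (name C υ w) (σ⊆τ , τ⊆σ) (τ⊆υ , υ⊆τ) =
    (λ a q q≤p q≤s r r≤q →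
      let r₁ , r₁≤r  , b , r₁≤t , eq₁ = σ⊆τ a q q≤p q≤s r r≤q
          r₂ , r₂≤r₁ , c , r₂≤w , eq₂ = τ⊆υ b r₁ (≤ᴾ-trans r₁≤r (≤ᴾ-trans r≤q q≤p)) r₁≤t r₁ ≤ᴾ-refl
      in  r₂ , ≤ᴾ-trans r₂≤r₁ r₁≤r , c , r₂≤w ,
          ≈-trans (σ a) (τ b) (υ c) (≈-mono (σ a) (τ b) r₂≤r₁ eq₁) eq₂) ,
    (λ c q q≤p q≤w r r≤q →
      let r₁ , r₁≤r  , b , r₁≤t , eq₁ = υ⊆τ c q q≤p q≤w r r≤q
          r₂ , r₂≤r₁ , a , r₂≤s , eq₂ = τ⊆σ b r₁ (≤ᴾ-trans r₁≤r (≤ᴾ-trans r≤q q≤p)) r₁≤t r₁ ≤ᴾ-refl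
      in  r₂ , ≤ᴾ-trans r₂≤r₁ r₁≤r , a , r₂≤s ,
          ≈-trans (σ a) (τ b) (υ c) eq₂ (≈-mono (τ b) (υ c) r₂≤r₁ eq₁))

  ε-mono : ∀ {p q} σ τ → q ≤ᴾ p → p ⊩ σ ε τ → q ⊩ σ ε τ
  ε-mono σ (name _ _ _) q≤p σετ r r≤q = σετ r (≤ᴾ-trans r≤q q≤p)

  ε-respʳ : ∀ {p} σ τ υ → p ⊩ τ ≈ υ → p ⊩ σ ε τ → p ⊩ σ ε υ
  ε-respʳ σ (name B τ t) (name C υ w) (τ⊆υ , _) σετ q q≤p =
    let r₁ , r₁≤q  , b , r₁≤t , eq₁ = σετ q q≤p
        r₂ , r₂≤r₁ , c , r₂≤w , eq₂ = τ⊆υ b r₁ (≤ᴾ-trans r₁≤q q≤p) r₁≤t r₁ ≤ᴾ-refl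
    in  r₂ , ≤ᴾ-trans r₂≤r₁ r₁≤q , c , r₂≤w ,
        ≈-trans σ (τ b) (υ c) (≈-mono σ (τ b) r₂≤r₁ eq₁) eq₂

  ε-check⁺ : ∀ {p x} σ y → x ∈ⱽ y → p ⊩ σ ≈ check x → p ⊩ σ ε check y
  ε-check⁺ σ (set A f) (a , refl) eq q q≤p =
    -- A check name pairs each element with every condition, so `q` itself can be the attached
    -- condition.
    q , ≤ᴾ-refl , (a , q) , ≤ᴾ-refl , ≈-mono σ (check (f a)) q≤p eq

  ε-check⁻ : ∀ {p} σ y → p ⊩ σ ε check y → ∃[ x ] ∃[ q ] (x ∈ⱽ y × q ≤ᴾ p × q ⊩ σ ≈ check x)
  ε-check⁻ {p} σ (set A f) σεy =
    let q , q≤p , (a , _) , _ , eq = σεy p ≤ᴾ-refl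
    in  f a , q , (a , refl) , q≤p , eq

  ε-numeral⁻ : ∀ {p} σ n → p ⊩ σ ε check (numeral n) →
               ∃[ m ] ∃[ q ] (m < n × q ≤ᴾ p × q ⊩ σ ≈ check (numeral m))
  ε-numeral⁻ σ n σεn with x , q , x∈n , q≤p , eq ← ε-check⁻ σ (numeral n) σεn
                     with m , m<n , refl ← ∈-numeral⁻ n x∈n = m , q , m<n , q≤p , eq

  -- Descent: if n is forced into itself, an extension forces n = m for some m < n; as m lies in n,
  -- m is then forced into itself.
  numeral-ε-irrefl : ∀ n p → ¬ (p ⊩ check (numeral n) ε check (numeral n))
  numeral-ε-irrefl = <-rec _ λ n rec p nεn →
    let m , q , m<n , _ , n≈m = ε-numeral⁻ (check (numeral n)) n nεn
        m̌ = check (numeral m)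
        ň = check (numeral n)
    in  rec m<n q (ε-respʳ m̌ ň m̌ n≈m (ε-check⁺ m̌ (numeral n) (∈-numeral⁺ m<n) (≈-refl m̌)))

  -- Otherwise the smaller numeral is a member of the larger, and the forced equality puts a numeral
  -- into itself.
  numeral-≈⇒≡ : ∀ {p} m n → p ⊩ check (numeral m) ≈ check (numeral n) → m ≡ n
  numeral-≈⇒≡ m n m≈n with <-cmp m n
  ... | tri≈ _ m≡n _ = m≡n
  ... | tri< m<n _ _ = ⊥-elim (numeral-ε-irrefl n _ (ε-check⁺ ň (numeral n) (∈-numeral⁺ m<n) (≈-sym m̌ ň m≈n)))
    where m̌ = check (numeral m)
          ň = check (numeral n)
  ... | tri> _ _ n<m = ⊥-elim (numeral-ε-irrefl m _ (ε-check⁺ m̌ (numeral m) (∈-numeral⁺ n<m) m≈n))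
    where m̌ = check (numeral m)

  numeral-ε⇒< : ∀ {p} m n → p ⊩ check (numeral m) ε check (numeral n) → m < n
  numeral-ε⇒< m n mεn with k , _ , k<n , _ , eq ← ε-numeral⁻ (check (numeral m)) n mεn
                      with refl ← numeral-≈⇒≡ m k eq = k<n

  InfinitelyOften : ℙ → (ℕ → ℙ) → Set ℓ
  InfinitelyOften q p̄ = ∀ m r → r ≤ᴾ q → ∃[ r′ ] (r′ ≤ᴾ r × ∃[ n ] (m < n × r′ ≤ᴾ p̄ n))

  module _ (em : ∀ {a} → ExcludedMiddle a) where
    ⊩infinite⇒InfinitelyOften : ∀ {q p̄} → q ⊩ infinite [ Ẇ p̄ ∷ check ω ∷ [] ] → InfinitelyOften q p̄
    ⊩infinite⇒InfinitelyOften {q} {p̄} q⊩ m r r≤q = decidable-stable em λ none →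
      -- The existential is a negated universal, so the argument is by contradiction: if no `r′`
      -- exists, `r` forces that no element of `Ẇ p̄` exceeds m, against `q`.
      q⊩ m̌ r r≤q
        ( lift (ε-check⁺ m̌ ω (lift m , refl) (≈-refl m̌))
        , λ r₁ r₁≤r r₁⊩∃ → r₁⊩∃ r₁ ≤ᴾ-refl λ { σ r₂ r₂≤r₁ (lift σεW , lift mεσ) →
            -- `r₃` decides `σ` to be a numeral n and lies below `p̄ n`.
            let r₃ , r₃≤r₂ , lift n , r₃≤pn , σ≈n = σεW r₂ ≤ᴾ-refl
                ň = check (numeral n)
                mεn = ε-respʳ m̌ σ ň σ≈n (ε-mono m̌ σ r₃≤r₂ mεσ)
            in  none (r₃ , ≤ᴾ-trans r₃≤r₂ (≤ᴾ-trans r₂≤r₁ r₁≤r) , n , numeral-ε⇒< m n mεn , r₃≤pn) } )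
      where
      m̌ = check (numeral m)

    InfinitelyOften⇒⊩infinite : ∀ {q p̄} → InfinitelyOften q p̄ → q ⊩ infinite [ Ẇ p̄ ∷ check ω ∷ [] ]
    InfinitelyOften⇒⊩infinite often τ q₁ q₁≤q (lift τεω , q₁⊩¬∃) =
      -- First decide `τ` as a numeral m, then pass below some `p̄ n` with n > m; `ň` is the witness
      -- that `q₁` was to exclude.
      let r , r≤q₁ , (lift m , _) , _ , τ≈m = τεω q₁ ≤ᴾ-refl
          r′ , r′≤r , n , m<n , r′≤pn = often m r (≤ᴾ-trans r≤q₁ q₁≤q)
          m̌ = check (numeral m)
          ň = check (numeral n)
      in  q₁⊩¬∃ r′ (≤ᴾ-trans r′≤r r≤q₁) λ s s≤r′ s⊩∀¬ →
            s⊩∀¬ ň s ≤ᴾ-refl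
              ( lift (λ t t≤s → t , ≤ᴾ-refl , lift n , ≤ᴾ-trans t≤s (≤ᴾ-trans s≤r′ r′≤pn) , ≈-refl ň)
              , lift (ε-check⁺ τ (numeral n) (∈-numeral⁺ m<n) (≈-mono τ m̌ (≤ᴾ-trans s≤r′ r′≤r) τ≈m)) )

-- Pairing natural numbers.

ℕ-pair : ℕ → ℕ → ℕ
ℕ-pair zero    n = suc (2 * n)
ℕ-pair (suc m) n = 2 * ℕ-pair m n

-- The value is 2^m (2n + 1), so parity separates the cases and factors 2 cancel.
ℕ-pair-injective : ∀ m n m′ n′ → ℕ-pair m n ≡ ℕ-pair m′ n′ → (m , n) ≡ (m′ , n′)
ℕ-pair-injective zero    n zero     n′ eq = cong (zero ,_) (*-cancelˡ-≡ n n′ 2 (suc-injective eq))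
ℕ-pair-injective zero    n (suc m′) n′ eq = ⊥-elim (even≢odd (ℕ-pair m′ n′) n (sym eq))
ℕ-pair-injective (suc m) n zero     n′ eq = ⊥-elim (even≢odd (ℕ-pair m n) n′ eq)
ℕ-pair-injective (suc m) n (suc m′) n′ eq
  with refl ← ℕ-pair-injective m n m′ n′ (*-cancelˡ-≡ _ _ 2 eq) = refl

ℕ×ℕ↣ℕ : (ℕ × ℕ) ↣ ℕ
ℕ×ℕ↣ℕ = mk↣ {to = uncurry ℕ-pair} (ℕ-pair-injective _ _ _ _)

-- With Boolean values, families of subsets stay in the universe of `E`, and extensionality
-- identifies subsets with the same elements.
Subset : Set a → Set a
Subset E = E → Bool

infix 4 _⊆_

_⊆_ : Subset A → Subset A → Set _
X ⊆ Y = ∀ e → T (X e) → T (Y e)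

T-antisym : ∀ x y → (T x → T y) → (T y → T x) → x ≡ y
T-antisym false false _ _ = refl
T-antisym false true  _ g = ⊥-elim (g _)
T-antisym true  false f _ = ⊥-elim (f _)
T-antisym true  true  _ _ = refl

-- Classical comprehension, unions and chains.

module Classical (em : ∀ {a} → ExcludedMiddle a) where

  ¬∀⇒∃¬ : {P : A → Set b} → ¬ (∀ x → P x) → ∃[ x ] ¬ P x
  ¬∀⇒∃¬ ¬∀ = decidable-stable em λ none → ¬∀ λ x → decidable-stable em λ ¬Px → none (x , ¬Px)

  ⟪_⟫ : Set a → Bool
  ⟪ A ⟫ = ⌊ em {P = A} ⌋

  ⟪⟫⁺ : A → T ⟪ A ⟫
  ⟪⟫⁺ = fromWitness {a? = em}

  ⟪⟫⁻ : T ⟪ A ⟫ → A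
  ⟪⟫⁻ = toWitness {a? = em}

  ⋃ : Subset (Subset A) → Subset A
  ⋃ C e = ⟪ ∃[ X ] (T (C X) × T (X e)) ⟫

  ⊆-⋃ : ∀ {C : Subset (Subset A)} {X} → T (C X) → X ⊆ ⋃ C
  ⊆-⋃ {X = X} X∈C e e∈X = ⟪⟫⁺ (X , X∈C , e∈X)

  ⋃-⊆ : ∀ {C : Subset (Subset A)} {Y} → (∀ X → T (C X) → X ⊆ Y) → ⋃ C ⊆ Y
  ⋃-⊆ C⊆Y e e∈⋃ = let X , X∈C , e∈X = ⟪⟫⁻ e∈⋃ in C⊆Y X X∈C e e∈X

  Chain : Subset (Subset A) → Set _
  Chain C = ∀ {X Y} → T (C X) → T (C Y) → X ⊆ Y ⊎ Y ⊆ X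

  -- The larger of two members of the chain contains both points; conditions on two points thus pass
  -- to the union.
  chain-common : {C : Subset (Subset A)} → Chain C → ∀ {e e′} → T (⋃ C e) → T (⋃ C e′) →
                 ∃[ X ] (T (C X) × T (X e) × T (X e′))
  chain-common chain {e} {e′} p q with ⟪⟫⁻ p | ⟪⟫⁻ q
  ... | X , X∈C , e∈X | Y , Y∈C , e′∈Y with chain X∈C Y∈C
  ...   | inj₁ X⊆Y = Y , Y∈C , X⊆Y e e∈X , e′∈Y
  ...   | inj₂ Y⊆X = X , X∈C , e∈X , Y⊆X e′ e′∈Y

  ChainClosed : Pred (Subset A) b → Set _
  ChainClosed Good = ∀ C → ∃[ X ] T (C X) → Chain C → (∀ X → T (C X) → Good X) → Good (⋃ C)

  -- Zorn's lemma.

  module Zorn (ext : ∀ {a b} → Extensionality a b)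
              {E : Set ℓ} (Good : Pred (Subset E) ℓ) (closed : ChainClosed Good)
              (X₀ : Subset E) (good₀ : Good X₀) where

    ⊆-antisym : ∀ {X Y : Subset E} → X ⊆ Y → Y ⊆ X → X ≡ Y
    ⊆-antisym {X} {Y} X⊆Y Y⊆X = ext λ e → T-antisym (X e) (Y e) (X⊆Y e) (Y⊆X e)

    Extension : Subset E → Set ℓ
    Extension X = ∃[ Y ] (Good Y × X ⊆ Y × ¬ (Y ⊆ X))

    -- Choice enters here: excluded middle for the Σ-type `Extension X` returns an actual proper
    -- extension.
    next : Subset E → Subset E
    next X with em {P = Extension X}
    ... | yes (Y , _) = Y
    ... | no _        = X

    ⊆-next : ∀ X → X ⊆ next X
    ⊆-next X with em {P = Extension X}
    ... | yes (_ , _ , X⊆Y , _) = X⊆Y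
    ... | no _                  = λ _ e∈X → e∈X

    next-good : ∀ {X} → Good X → Good (next X)
    next-good {X} good with em {P = Extension X}
    ... | yes (_ , goodY , _) = goodY
    ... | no _                = good

    next-⊆⇒maximal : ∀ {X} → next X ⊆ X → ¬ Extension X
    next-⊆⇒maximal {X} next⊆X with em {P = Extension X}
    ... | yes (_ , _ , _ , Y⊈X) = ⊥-elim (Y⊈X next⊆X)
    ... | no none               = none

    -- The members of the tower are pairwise comparable, so its union is its
    -- largest member and is fixed by next.
    data Tower : Subset E → Set ℓ where
      base : Tower X₀
      step : ∀ {X} → Tower X → Tower (next X)
      sup  : ∀ C → ∃[ X ] T (C X) → (∀ X → T (C X) → Tower X) → Tower (⋃ C)

    X₀⊆ : ∀ {X} → Tower X → X₀ ⊆ X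
    X₀⊆ base                = λ _ e∈X → e∈X
    X₀⊆ (step {X} t) e e∈X₀ = ⊆-next X e (X₀⊆ t e e∈X₀)
    X₀⊆ (sup C (X , X∈C) ts) e e∈X₀ = ⊆-⋃ {C = C} X∈C e (X₀⊆ (ts X X∈C) e e∈X₀)

    -- The extreme points of the Bourbaki-Witt argument.
    Splits : Subset E → Set ℓ
    Splits Y = ∀ {X} → Tower X → X ⊆ Y → Y ⊆ X ⊎ next X ⊆ Y

    -- Induction on `X`: while `X` is below `Y`, splitting keeps `next X` below `Y` unless `X`
    -- equals `Y`, and then `next X` is `next Y`.
    next⊆⊎⊆ : ∀ {X Y} → Tower X → Tower Y → Splits Y → next Y ⊆ X ⊎ X ⊆ Y
    next⊆⊎⊆ base tY split = inj₂ (X₀⊆ tY)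
    next⊆⊎⊆ (step {X} tX) tY split with next⊆⊎⊆ tX tY split
    ... | inj₁ nY⊆X = inj₁ λ e e∈nY → ⊆-next X e (nY⊆X e e∈nY)
    ... | inj₂ X⊆Y with split tX X⊆Y
    ...   | inj₂ nX⊆Y = inj₂ nX⊆Y
    ...   | inj₁ Y⊆X with refl ← ⊆-antisym X⊆Y Y⊆X = inj₁ λ _ e∈ → e∈
    next⊆⊎⊆ {Y = Y} (sup C _ ts) tY split with em {P = ∃[ X ] (T (C X) × next Y ⊆ X)}
    ... | yes (X , X∈C , nY⊆X) = inj₁ λ e e∈ → ⊆-⋃ {C = C} X∈C e (nY⊆X e e∈)
    ... | no none = inj₂ (⋃-⊆ {C = C} λ X X∈C →
            [ (λ nY⊆X → ⊥-elim (none (X , X∈C , nY⊆X))) , (λ X⊆Y → X⊆Y) ] (next⊆⊎⊆ (ts X X∈C) tY split))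

    splits : ∀ {Y} → Tower Y → Splits Y
    splits base tX _ = inj₁ (X₀⊆ tX)
    splits (step {Y} tY) tX X⊆nY with next⊆⊎⊆ tX tY (splits tY)
    ... | inj₁ nY⊆X = inj₁ nY⊆X
    ... | inj₂ X⊆Y with splits tY tX X⊆Y
    ...   | inj₂ nX⊆Y = inj₂ λ e e∈ → ⊆-next Y e (nX⊆Y e e∈)
    ...   | inj₁ Y⊆X with refl ← ⊆-antisym X⊆Y Y⊆X = inj₂ λ _ e∈ → e∈
    splits (sup C _ ts) {X} tX X⊆⋃ with em {P = ∃[ Y ] (T (C Y) × ¬ (Y ⊆ X))}
    ... | no none = inj₁ (⋃-⊆ {C = C} λ Y Y∈C → decidable-stable em λ Y⊈X → none (Y , Y∈C , Y⊈X))
    -- A member `Y` of the chain not below `X` must lie above `X`, so its own splitting decides.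
    ... | yes (Y , Y∈C , Y⊈X) with next⊆⊎⊆ tX (ts Y Y∈C) (splits (ts Y Y∈C))
    ...   | inj₁ nY⊆X = ⊥-elim (Y⊈X λ e e∈Y → nY⊆X e (⊆-next Y e e∈Y))
    ...   | inj₂ X⊆Y with splits (ts Y Y∈C) tX X⊆Y
    ...     | inj₁ Y⊆X  = ⊥-elim (Y⊈X Y⊆X)
    ...     | inj₂ nX⊆Y = inj₂ λ e e∈ → ⊆-⋃ {C = C} Y∈C e (nX⊆Y e e∈)

    tower-total : ∀ {X Y} → Tower X → Tower Y → X ⊆ Y ⊎ Y ⊆ X
    tower-total {X} {Y} tX tY with next⊆⊎⊆ tX tY (splits tY)
    ... | inj₁ nY⊆X = inj₂ λ e e∈Y → nY⊆X e (⊆-next Y e e∈Y)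
    ... | inj₂ X⊆Y  = inj₁ X⊆Y

    tower-good : ∀ {X} → Tower X → Good X
    tower-good base       = good₀
    tower-good (step t)   = next-good (tower-good t)
    tower-good (sup C ne ts) =
      closed C ne (λ X∈C Y∈C → tower-total (ts _ X∈C) (ts _ Y∈C)) (λ X X∈C → tower-good (ts X X∈C))

    maximal : ∃[ X ] (Good X × X₀ ⊆ X × (∀ Y → Good Y → X ⊆ Y → Y ⊆ X))
    maximal = top , tower-good top-tower , X₀⊆ top-tower , λ Y goodY top⊆Y →
      decidable-stable em λ Y⊈top →
        next-⊆⇒maximal (⊆-⋃ {C = C} (⟪⟫⁺ (step top-tower))) (Y , goodY , top⊆Y , Y⊈top)
      where
      C : Subset (Subset E)
      C X = ⟪ Tower X ⟫
      top = ⋃ C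
      top-tower : Tower top
      top-tower = sup C (X₀ , ⟪⟫⁺ base) (λ X → ⟪⟫⁻)

  -- Comparability of cardinals, and squares of infinite sets.

  module Cardinality (ext : ∀ {a b} → Extensionality a b) where

    module _ {A B : Set ℓ} where
      record PartialInjection (R : Subset (A × B)) : Set ℓ where
        field
          functional : ∀ {x y y′} → T (R (x , y)) → T (R (x , y′)) → y ≡ y′
          injective  : ∀ {x x′ y} → T (R (x , y)) → T (R (x′ , y)) → x ≡ x′
      open PartialInjection

      partialInjection-closed : ChainClosed PartialInjection
      partialInjection-closed C _ chain good = record
        { functional = λ p q → let R , R∈C , p′ , q′ = common p q in functional (good R R∈C) p′ q′
        ; injective  = λ p q → let R , R∈C , p′ , q′ = common p q in injective (good R R∈C) p′ q′
        }
        where common = chain-common {C = C} chain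

      -- A maximal partial injection is total or onto: otherwise a missing argument and a missing
      -- value could be matched.
      ↣-total : (A ↣ B) ⊎ (B ↣ A)
      ↣-total with Zorn.maximal ext PartialInjection partialInjection-closed (λ _ → false)
                     (record { functional = λ () ; injective = λ () })
      ... | R , good , _ , max with em {P = ∀ x → ∃[ y ] T (R (x , y))} | em {P = ∀ y → ∃[ x ] T (R (x , y))}
      ...   | yes total | _ = inj₁ (mk↣ {to = proj₁ ∘ total} λ {x} {x′} eq →
                injective good (proj₂ (total x)) (subst (λ y → T (R (x′ , y))) (sym eq) (proj₂ (total x′))))
      ...   | no _ | yes onto = inj₂ (mk↣ {to = proj₁ ∘ onto} λ {y} {y′} eq →
                functional good (proj₂ (onto y)) (subst (λ x → T (R (x , y′))) (sym eq) (proj₂ (onto y′))))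
      ...   | no ¬total | no ¬onto =
                ⊥-elim (x∉ (y , max R′ good′ (λ _ p → ⟪⟫⁺ (inj₁ p)) (x , y) (⟪⟫⁺ (inj₂ refl))))
        where
        x = proj₁ (¬∀⇒∃¬ ¬total)
        x∉ = proj₂ (¬∀⇒∃¬ ¬total)
        y = proj₁ (¬∀⇒∃¬ ¬onto)
        y∉ = proj₂ (¬∀⇒∃¬ ¬onto)
        R′ : Subset (A × B)
        R′ e = ⟪ T (R e) ⊎ e ≡ (x , y) ⟫
        functional′ : ∀ {u v v′} → T (R (u , v)) ⊎ (u , v) ≡ (x , y) → T (R (u , v′)) ⊎ (u , v′) ≡ (x , y) → v ≡ v′
        functional′ (inj₁ p)    (inj₁ q)    = functional good p q
        functional′ (inj₁ p)    (inj₂ refl) = ⊥-elim (x∉ (_ , p))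
        functional′ (inj₂ refl) (inj₁ q)    = ⊥-elim (x∉ (_ , q))
        functional′ (inj₂ refl) (inj₂ refl) = refl
        injective′ : ∀ {u u′ v} → T (R (u , v)) ⊎ (u , v) ≡ (x , y) → T (R (u′ , v)) ⊎ (u′ , v) ≡ (x , y) → u ≡ u′
        injective′ (inj₁ p)    (inj₁ q)    = injective good p q
        injective′ (inj₁ p)    (inj₂ refl) = ⊥-elim (y∉ (_ , p))
        injective′ (inj₂ refl) (inj₁ q)    = ⊥-elim (y∉ (_ , q))
        injective′ (inj₂ refl) (inj₂ refl) = refl
        good′ : PartialInjection R′
        good′ = record
          { functional = λ p q → functional′ (⟪⟫⁻ p) (⟪⟫⁻ q)
          ; injective  = λ p q → injective′ (⟪⟫⁻ p) (⟪⟫⁻ q)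
          }

    module _ {M : Set ℓ} where
      -- A subset of this type stores a set X ⊆ M (first summand) together with
      -- the graph of a binary operation on X.
      Triples : Set ℓ
      Triples = M ⊎ M × M × M

      record Pairing (R : Subset Triples) : Set ℓ where
        field
          functional : ∀ {x y z z′} → T (R (inj₂ (x , y , z))) → T (R (inj₂ (x , y , z′))) → z ≡ z′
          injective  : ∀ {x y x′ y′ z} → T (R (inj₂ (x , y , z))) → T (R (inj₂ (x′ , y′ , z))) → (x , y) ≡ (x′ , y′)
          total      : ∀ {x y} → T (R (inj₁ x)) → T (R (inj₁ y)) → ∃[ z ] (T (R (inj₁ z)) × T (R (inj₂ (x , y , z))))
          supported  : ∀ {x y z} → T (R (inj₂ (x , y , z))) → T (R (inj₁ x)) × T (R (inj₁ y))
      open Pairing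

      pairing-closed : ChainClosed Pairing
      pairing-closed C _ chain good = record
        { functional = λ p q → let R , R∈C , p′ , q′ = common p q in functional (good R R∈C) p′ q′
        ; injective  = λ p q → let R , R∈C , p′ , q′ = common p q in injective (good R R∈C) p′ q′
        ; total      = λ p q → let R , R∈C , p′ , q′ = common p q
                                   z , z∈ , xyz = total (good R R∈C) p′ q′
                               in  z , ⊆-⋃ {C = C} R∈C _ z∈ , ⊆-⋃ {C = C} R∈C _ xyz
        ; supported  = λ p → let R , R∈C , p′ = ⟪⟫⁻ p
                                 x∈ , y∈ = supported (good R R∈C) p′
                             in  ⊆-⋃ {C = C} R∈C _ x∈ , ⊆-⋃ {C = C} R∈C _ y∈
        }
        where common = chain-common {C = C} chain

      module _ {A : Set a} (ι : A ↣ M) (pair : (A × A) ↣ A) where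
        open Injection ι using () renaming (to to e; injective to e-injective)
        open Injection pair using () renaming (to to f; injective to f-injective)

        -- The pairing on `A` carried over to its image in `M`: for ℕ it starts Zorn's lemma, for
        -- `D ⊎ D` it gives the extension.
        data InGraph : Triples → Set (a Level.⊔ ℓ) where
          element : ∀ x → InGraph (inj₁ (e x))
          triple  : ∀ x y → InGraph (inj₂ (e x , e y , e (f (x , y))))

        graph : Subset Triples
        graph t = ⟪ InGraph t ⟫

        element⁻ : ∀ {m} → InGraph (inj₁ m) → ∃[ x ] m ≡ e x
        element⁻ (element x) = x , refl

        triple⁻ : ∀ {m n k} → InGraph (inj₂ (m , n , k)) →
                  ∃[ x ] ∃[ y ] (m ≡ e x × n ≡ e y × k ≡ e (f (x , y)))
        triple⁻ (triple x y) = x , y , refl , refl , refl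

        graph-pairing : Pairing graph
        graph-pairing = record
          { functional = λ p q → functional′ (triple⁻ (⟪⟫⁻ p)) (triple⁻ (⟪⟫⁻ q))
          ; injective  = λ p q → injective′ (triple⁻ (⟪⟫⁻ p)) (triple⁻ (⟪⟫⁻ q))
          ; total      = λ p q → total′ (element⁻ (⟪⟫⁻ p)) (element⁻ (⟪⟫⁻ q))
          ; supported  = λ p → supported′ (⟪⟫⁻ p)
          }
          where
          Triple : M → M → M → Set _
          Triple m n k = ∃[ x ] ∃[ y ] (m ≡ e x × n ≡ e y × k ≡ e (f (x , y)))

          functional′ : ∀ {m n k k′} → Triple m n k → Triple m n k′ → k ≡ k′
          functional′ (x , y , refl , refl , refl) (x′ , y′ , p , q , refl) =
            cong₂ (λ x y → e (f (x , y))) (e-injective p) (e-injective q)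

          injective′ : ∀ {m n m′ n′ k} → Triple m n k → Triple m′ n′ k → (m , n) ≡ (m′ , n′)
          injective′ (x , y , refl , refl , refl) (x′ , y′ , refl , refl , p)
            with refl ← f-injective (e-injective p) = refl

          total′ : ∀ {m n} → ∃[ x ] m ≡ e x → ∃[ y ] n ≡ e y →
                   ∃[ k ] (T (graph (inj₁ k)) × T (graph (inj₂ (m , n , k))))
          total′ (x , refl) (y , refl) = e (f (x , y)) , ⟪⟫⁺ (element _) , ⟪⟫⁺ (triple x y)

          supported′ : ∀ {m n k} → InGraph (inj₂ (m , n , k)) → T (graph (inj₁ m)) × T (graph (inj₁ n))
          supported′ (triple x y) = ⟪⟫⁺ (element x) , ⟪⟫⁺ (element y)

      -- Take a maximal pairing, with underlying set D.  If D embeds in its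
      -- complement, the pairing extends to a copy of D ⊎ D in M, contradicting
      -- maximality; otherwise M embeds in D ⊎ D, hence in D.
      ×-↣ : ℕ ↣ M → (M × M) ↣ M
      ×-↣ ι with Zorn.maximal ext Pairing pairing-closed (graph ι ℕ×ℕ↣ℕ) (graph-pairing ι ℕ×ℕ↣ℕ)
      ... | R , good , ℕ⊆R , max = [ ⊥-elim ∘ D↣Dᶜ-impossible , Dᶜ↣D⇒ ] ↣-total
        where
        D Dᶜ : Set ℓ
        D = Σ[ m ∈ M ] T (R (inj₁ m))
        Dᶜ = Σ[ m ∈ M ] ¬ T (R (inj₁ m))

        D-≡ : ∀ {x y : D} → proj₁ x ≡ proj₁ y → x ≡ y
        D-≡ {_ , p} {_ , q} refl = cong (_ ,_) (T-irrelevant p q)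

        f : D × D → D
        f ((_ , m∈) , (_ , n∈)) = let k , k∈ , _ = total good m∈ n∈ in k , k∈

        f-graph : ∀ x y → T (R (inj₂ (proj₁ x , proj₁ y , proj₁ (f (x , y)))))
        f-graph (_ , m∈) (_ , n∈) = proj₂ (proj₂ (total good m∈ n∈))

        f-injective : ∀ {p q} → f p ≡ f q → p ≡ q
        f-injective {x , y} {x′ , y′} eq =
          let p , q = ,-injective (injective good (f-graph x y)
                        (subst (λ k → T (R (inj₂ (proj₁ x′ , proj₁ y′ , k)))) (sym (cong proj₁ eq)) (f-graph x′ y′)))
          in  cong₂ _,_ (D-≡ p) (D-≡ q)

        -- The maximal pairing contains the copy of ℕ, so `D` has two distinct elements to use as
        -- tags.
        c : ℕ → D
        c n = Injection.to ι n , ℕ⊆R _ (⟪⟫⁺ (element n))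

        c₀≢c₁ : ¬ c 0 ≡ c 1
        c₀≢c₁ eq with () ← Injection.injective ι (cong proj₁ eq)

        -- D ⊎ D embeds in D: the first argument of f serves as a tag.
        tag : D ⊎ D → D
        tag (inj₁ x) = f (c 0 , x)
        tag (inj₂ x) = f (c 1 , x)

        tag-injective : ∀ {u v} → tag u ≡ tag v → u ≡ v
        tag-injective {inj₁ x} {inj₁ y} eq = cong inj₁ (proj₂ (,-injective (f-injective eq)))
        tag-injective {inj₁ x} {inj₂ y} eq = ⊥-elim (c₀≢c₁ (proj₁ (,-injective (f-injective eq))))
        tag-injective {inj₂ x} {inj₁ y} eq = ⊥-elim (c₀≢c₁ (sym (proj₁ (,-injective (f-injective eq)))))
        tag-injective {inj₂ x} {inj₂ y} eq = cong inj₂ (proj₂ (,-injective (f-injective eq)))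

        -- On the first copy of `D` it must agree with `f`, so that the new pairing extends `R`; all
        -- other pairs are sent to the second copy.
        g : (D ⊎ D) × (D ⊎ D) → D ⊎ D
        g (inj₁ x , inj₁ y) = inj₁ (f (x , y))
        g (u      , v)      = inj₂ (f (tag u , tag v))

        untag : ∀ {u v u′ v′} → inj₂ {A = D} (f (tag u , tag v)) ≡ inj₂ (f (tag u′ , tag v′)) → (u , v) ≡ (u′ , v′)
        untag eq = let p , q = ,-injective (f-injective (inj₂-injective eq))
                   in  cong₂ _,_ (tag-injective p) (tag-injective q)

        g-injective : ∀ {p q} → g p ≡ g q → p ≡ q
        g-injective {inj₁ x , inj₁ y} {inj₁ x′ , inj₁ y′} eq with refl ← f-injective (inj₁-injective eq) = refl
        g-injective {inj₁ x , inj₁ y} {inj₁ x′ , inj₂ y′} ()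
        g-injective {inj₁ x , inj₁ y} {inj₂ x′ , _}       ()
        g-injective {inj₁ x , inj₂ y} {inj₁ x′ , inj₁ y′} ()
        g-injective {inj₂ x , _}      {inj₁ x′ , inj₁ y′} ()
        g-injective {inj₁ x , inj₂ y} {inj₁ x′ , inj₂ y′} eq = untag eq
        g-injective {inj₁ x , inj₂ y} {inj₂ x′ , _}       eq = untag eq
        g-injective {inj₂ x , _}      {inj₁ x′ , inj₂ y′} eq = untag eq
        g-injective {inj₂ x , _}      {inj₂ x′ , _}       eq = untag eq

        D↣Dᶜ-impossible : ¬ (D ↣ Dᶜ)
        D↣Dᶜ-impossible j =
            -- The second copy of `c 0` lies outside `D`, yet maximality would put it inside.
            proj₂ (h (c 0)) (max R′ (graph-pairing ι′ (mk↣ g-injective)) R⊆R′ _ (⟪⟫⁺ (element (inj₂ (c 0)))))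
          where
          h = Injection.to j

          e : D ⊎ D → M
          e = [ proj₁ , proj₁ ∘ h ]

          Dᶜ-≡ : ∀ {x y : Dᶜ} → proj₁ x ≡ proj₁ y → x ≡ y
          Dᶜ-≡ {_ , p} {_ , q} refl = cong (_ ,_) (ext λ t → ⊥-elim (p t))

          e-injective : ∀ {u v} → e u ≡ e v → u ≡ v
          e-injective {inj₁ x} {inj₁ y} eq = cong inj₁ (D-≡ eq)
          e-injective {inj₁ x} {inj₂ y} eq = ⊥-elim (proj₂ (h y) (subst (λ m → T (R (inj₁ m))) eq (proj₂ x)))
          e-injective {inj₂ x} {inj₁ y} eq = ⊥-elim (proj₂ (h x) (subst (λ m → T (R (inj₁ m))) (sym eq) (proj₂ y)))
          e-injective {inj₂ x} {inj₂ y} eq = cong inj₂ (Injection.injective j (Dᶜ-≡ eq))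

          ι′ : (D ⊎ D) ↣ M
          ι′ = mk↣ e-injective

          R′ : Subset Triples
          R′ = graph ι′ (mk↣ g-injective)

          R⊆R′ : R ⊆ R′
          R⊆R′ (inj₁ m)           m∈ = ⟪⟫⁺ (element (inj₁ (m , m∈)))
          R⊆R′ (inj₂ (m , n , k)) t∈ with m∈ , n∈ ← supported good t∈
            with refl ← functional good t∈ (f-graph (m , m∈) (n , n∈)) =
            ⟪⟫⁺ (triple (inj₁ (m , m∈)) (inj₁ (n , n∈)))

        Dᶜ↣D⇒ : Dᶜ ↣ D → (M × M) ↣ M
        Dᶜ↣D⇒ j = mk↣ {to = λ (m , n) → proj₁ (f (r m , r n))} λ eq →
            let p , q = ,-injective (f-injective (D-≡ eq))
            in  cong₂ _,_ (r-injective p) (r-injective q)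
          where
          r₀ : M → D ⊎ D
          r₀ m with em {P = T (R (inj₁ m))}
          ... | yes m∈ = inj₁ (m , m∈)
          ... | no m∉  = inj₂ (Injection.to j (m , m∉))

          r₀-injective : ∀ {m n} → r₀ m ≡ r₀ n → m ≡ n
          r₀-injective {m} {n} eq with em {P = T (R (inj₁ m))} | em {P = T (R (inj₁ n))}
          ... | yes _ | yes _ = cong proj₁ (inj₁-injective eq)
          ... | no _  | no _  = cong proj₁ (Injection.injective j (inj₂-injective eq))
          r₀-injective () | yes _ | no _
          r₀-injective () | no _  | yes _

          r : M → D
          r = tag ∘ r₀

          r-injective : ∀ {m n} → r m ≡ r n → m ≡ n
          r-injective eq = r₀-injective (tag-injective eq)

-- Lengths of repetition-free lists.

unique-⊆⇒length≤ : {xs ys : List A} → Unique xs → (∀ {x} → x ∈ xs → x ∈ ys) → length xs ≤ length ys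
unique-⊆⇒length≤ []           _  = z≤n
-- Delete the head from `ys`; as it does not recur in the tail, the tail still lies in `as ++ bs`.
unique-⊆⇒length≤ {xs = x ∷ xs} (x∉xs ∷ uniq) xs⊆ys with as , bs , refl ← ∈-∃++ (xs⊆ys (here refl)) =
  ≤-trans (s≤s (unique-⊆⇒length≤ uniq xs⊆as++bs))
    (≤-reflexive (trans (cong suc (length-++ as)) (trans (sym (+-suc (length as) (length bs))) (sym (length-++ as)))))
  where
  xs⊆as++bs : ∀ {y} → y ∈ xs → y ∈ as ++ bs
  xs⊆as++bs y∈xs with ∈-++⁻ as (xs⊆ys (there y∈xs))
  ... | inj₁ y∈as         = ∈-++⁺ˡ y∈as
  ... | inj₂ (here refl)  = ⊥-elim (lookup x∉xs y∈xs refl)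
  ... | inj₂ (there y∈bs) = ∈-++⁺ʳ as y∈bs

-- Decision trees and their codes in `M`.

data DecisionTree (M : Set ℓ) : Set ℓ where
  leaf : M → DecisionTree M
  node : M → DecisionTree M → DecisionTree M → DecisionTree M

eval : {M : Set ℓ} → DecisionTree M → (M → Bool) → M
eval (leaf ζ)     b = ζ
eval (node m l r) b = if b m then eval l b else eval r b

module _ {M : Set ℓ} (ι : ℕ ↣ M) (pair : (M × M) ↣ M) where
  open Injection ι using () renaming (to to num; injective to num-injective)
  open Injection pair using () renaming (to to ⟨_⟩; injective to ⟨⟩-injective)

  -- The first component, `num 0` or `num 1`, records the constructor.
  encode : DecisionTree M → M
  encode (leaf ζ)     = ⟨ num 0 , ζ ⟩
  encode (node m l r) = ⟨ num 1 , ⟨ m , ⟨ encode l , encode r ⟩ ⟩ ⟩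

  encode-injective : ∀ {s t} → encode s ≡ encode t → s ≡ t
  encode-injective {leaf _} {leaf _} eq = cong leaf (,-injectiveʳ (⟨⟩-injective eq))
  encode-injective {leaf _} {node _ _ _} eq with () ← num-injective (proj₁ (,-injective (⟨⟩-injective eq)))
  encode-injective {node _ _ _} {leaf _} eq with () ← num-injective (proj₁ (,-injective (⟨⟩-injective eq)))
  encode-injective {node m l r} {node m′ l′ r′} eq
    with eq₁ ← ⟨⟩-injective (,-injectiveʳ (⟨⟩-injective eq))
    with refl ← proj₁ (,-injective eq₁)
    with eq₂ ← ⟨⟩-injective (,-injectiveʳ eq₁) =
    cong₂ (node m) (encode-injective (proj₁ (,-injective eq₂))) (encode-injective (proj₂ (,-injective eq₂)))

  -- The number is to be the size of a domain, so one element of `M` fixes both tree and size.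
  code : (DecisionTree M × ℕ) ↣ M
  code = mk↣ {to = λ (t , n) → ⟨ encode t , num n ⟩} λ eq →
    let p , q = ,-injective (⟨⟩-injective eq) in cong₂ _,_ (encode-injective p) (num-injective q)

-- Interpolation, weak Δ-systems and the pieces of the product.

module Proof (em : ∀ {a} → ExcludedMiddle a) (ext : ∀ {a b} → Extensionality a b) where
  open Classical em
  open ForcingProperties using (InfinitelyOften; ⊩infinite⇒InfinitelyOften; InfinitelyOften⇒⊩infinite)

  -- The Engelking–Karłowicz theorem: the |M| many functions i ↦ eval t (β i)
  -- interpolate every finite partial function from I to M.
  module _ {M I : Set ℓ} (β : I ↣ (M → Bool)) where
    open Injection β using () renaming (to to bits; injective to bits-injective)

    evalAt : DecisionTree M → I → M
    evalAt t i = eval t (bits i)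

    -- Induction on the points to be preserved. Branching on a bit that separates i from j sends i
    -- to `t′` and j to `t`; the other points may go either way, as `t′` and `t` agree on them.
    override : ∀ t i ζ js → i ∉ js → ∃[ t′ ] (evalAt t′ i ≡ ζ × (∀ {j} → j ∈ js → evalAt t′ j ≡ evalAt t j))
    override t i ζ []       _     = leaf ζ , refl , λ ()
    override t i ζ (j ∷ js) i∉js
      with t′ , t′i≡ζ , t′≗t ← override t i ζ js (i∉js ∘ there)
      with m , differ ← ¬∀⇒∃¬ {P = λ m → bits i m ≡ bits j m} (λ eq → i∉js (here (bits-injective (ext eq))))
      with bits i m in bᵢ | bits j m in bⱼ
    ... | true  | true  = ⊥-elim (differ refl)
    ... | false | false = ⊥-elim (differ refl)
    ... | true  | false = node m t′ t , atI , atJ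
      where
      atI : evalAt (node m t′ t) i ≡ ζ
      atI rewrite bᵢ = t′i≡ζ
      atJ : ∀ {k} → k ∈ j ∷ js → evalAt (node m t′ t) k ≡ evalAt t k
      atJ (here refl) rewrite bⱼ = refl
      atJ {k} (there k∈js) with bits k m
      ... | true  = t′≗t k∈js
      ... | false = refl
    ... | false | true  = node m t t′ , atI , atJ
      where
      atI : evalAt (node m t t′) i ≡ ζ
      atI rewrite bᵢ = t′i≡ζ
      atJ : ∀ {k} → k ∈ j ∷ js → evalAt (node m t t′) k ≡ evalAt t k
      atJ (here refl) rewrite bⱼ = refl
      atJ {k} (there k∈js) with bits k m
      ... | false = t′≗t k∈js
      ... | true  = refl

    -- One point is overridden at a time; the argument in `M` is the default leaf for the empty
    -- function.
    interpolate : M → ∀ {u} → Unique u → (s : ∀ i → i ∈ u → M) → ∃[ t ] (∀ i i∈u → evalAt t i ≡ s i i∈u)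
    interpolate ζ []                        s = leaf ζ , λ _ ()
    interpolate ζ {i ∷ u} (i∉u ∷ uniq) s
      with t , t≗s ← interpolate ζ uniq (λ j j∈u → s j (there j∈u))
      with t′ , t′i≡ , t′≗t ← override t i (s i (here refl)) u (All¬⇒¬Any i∉u) =
      t′ , λ { _ (here refl) → t′i≡ ; j (there j∈u) → trans (t′≗t j∈u) (t≗s j j∈u) }

  -- A weak Δ-system: outside the root, each point lies in only finitely many
  -- members of the subsequence, but the members need not be disjoint there.
  record WeakΔSystem {I : Set ℓ} (D : ℕ → FinSubset I) : Set ℓ where
    field
      root        : FinSubset I
      subsequence : ℕ → ℕ
      cofinal     : ∀ k → k ≤ subsequence k
      root⊆       : ∀ k {i} → i ∈ᶠ root → i ∈ᶠ D (subsequence k)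
      sparse      : ∀ {i} → ¬ i ∈ᶠ root → ∃[ m ] (∀ k → m ≤ k → ¬ i ∈ᶠ D (subsequence k))

  -- The root grows as long as some point outside it recurs; the bound n on the
  -- size of the members stops this after at most n steps.
  weakΔSystem : {I : Set ℓ} (D : ℕ → FinSubset I) (n : ℕ) → (∀ k → length (list (D k)) ≤ n) → WeakΔSystem D
  weakΔSystem {I = I} D n bounded =
    -- Fuel n + 1 establishes n < fuel + |u| for the empty root; at fuel 0 the root would be longer
    -- than a member containing it.
    grow (suc n) (record { list = [] ; unique = [] }) (λ k → k) (λ k → ≤-refl) (λ _ ()) (m≤m+n (suc n) 0)
    where
    grow : ∀ fuel (u : FinSubset I) (g : ℕ → ℕ) → (∀ k → k ≤ g k) → (∀ k {i} → i ∈ᶠ u → i ∈ᶠ D (g k)) →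
           n < fuel + length (list u) → WeakΔSystem D
    grow zero u g _ u⊆ n<∣u∣ =
      ⊥-elim (<-irrefl refl (<-≤-trans n<∣u∣ (≤-trans (unique-⊆⇒length≤ (unique u) (u⊆ 0)) (bounded (g 0)))))
    grow (suc fuel) u g g≥ u⊆ n<
      with em {P = ∃[ i ] (¬ i ∈ᶠ u × (∀ m → ∃[ k ] (m ≤ k × i ∈ᶠ D (g k))))}
    ... | yes (i , i∉u , recurs) =
      grow fuel (record { list = i ∷ list u ; unique = ¬Any⇒All¬ _ i∉u ∷ unique u })
        (λ m → g (proj₁ (recurs m)))
        (λ m → ≤-trans (proj₁ (proj₂ (recurs m))) (g≥ _))
        (λ { m (here refl) → proj₂ (proj₂ (recurs m)) ; m (there i∈u) → u⊆ _ i∈u })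
        (≤-trans n< (≤-reflexive (sym (+-suc fuel _))))
    ... | no none = record
      { root = u ; subsequence = g ; cofinal = g≥ ; root⊆ = u⊆
      ; sparse = λ {i} i∉u →
          let m , ¬recurs = ¬∀⇒∃¬ λ recurs → none (i , i∉u , recurs)
          in  m , λ k m≤k i∈ → ¬recurs (k , m≤k , i∈)
      }

  -- Unions of domains and amalgamation of conditions.

  module _ {I : Set ℓ} where
    _∪_ : FinSubset I → FinSubset I → FinSubset I
    u ∪ v = record { list = deduplicate (λ _ _ → em) (list u ++ list v) ; unique = deduplicate-! (λ _ _ → em) _ }

    ∪⁺ : ∀ u v {i} → i ∈ᶠ u ⊎ i ∈ᶠ v → i ∈ᶠ (u ∪ v)
    ∪⁺ u v i∈ = ∈-deduplicate⁺ (λ _ _ → em) ([ ∈-++⁺ˡ , ∈-++⁺ʳ (list u) ] i∈)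

    ∪⁻ : ∀ u v {i} → i ∈ᶠ (u ∪ v) → i ∈ᶠ u ⊎ i ∈ᶠ v
    ∪⁻ u v i∈ = ∈-++⁻ (list u) (∈-deduplicate⁻ (λ _ _ → em) (list u ++ list v) i∈)

  module _ {M I : Set ℓ} (Q : I → Poset ℓ ℓ ℓ) where
    private
      module Q (i : I) = Poset (Q i)
    open Condition

    module Amalgamation (u : FinSubset I) (r p : Condition Q) (t : Π Q u)
      (t≤r : ∀ i i∈u i∈r → Q._≤_ i (t i i∈u) (val r i i∈r))
      (t≤p : ∀ i i∈u i∈p → Q._≤_ i (t i i∈u) (val p i i∈p))
      (disjoint : ∀ i → i ∈ᶠ dom r → i ∈ᶠ dom p → i ∈ᶠ u) where

      value : Π Q (dom r ∪ dom p)
      value i i∈ with em {P = i ∈ᶠ u} | em {P = i ∈ᶠ dom r}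
      ... | yes i∈u | _       = t i i∈u
      ... | no _    | yes i∈r = val r i i∈r
      ... | no _    | no i∉r  = val p i ([ (λ i∈r → ⊥-elim (i∉r i∈r)) , (λ i∈p → i∈p) ] (∪⁻ (dom r) (dom p) i∈))

      amalgam : Condition Q
      amalgam = record { dom = dom r ∪ dom p ; val = value }

      value≤r : ∀ i i∈ i∈r → Q._≤_ i (value i i∈) (val r i i∈r)
      value≤r i i∈ i∈r with em {P = i ∈ᶠ u} | em {P = i ∈ᶠ dom r}
      ... | yes i∈u | _        = t≤r i i∈u i∈r
      -- The case split may return another membership proof; uniqueness of the domain list makes the
      -- two values equal.
      ... | no _    | yes i∈r′ = Q.reflexive i (Q.Eq.reflexive i (cong (val r i) (unique⇒irrelevant (unique (dom r)) i∈r′ i∈r)))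
      ... | no _    | no i∉r   = ⊥-elim (i∉r i∈r)

      value≤p : ∀ i i∈ i∈p → Q._≤_ i (value i i∈) (val p i i∈p)
      value≤p i i∈ i∈p with em {P = i ∈ᶠ u} | em {P = i ∈ᶠ dom r}
      ... | yes i∈u | _       = t≤p i i∈u i∈p
      ... | no i∉u  | yes i∈r = ⊥-elim (i∉u (disjoint i i∈r i∈p))
      ... | no _    | no i∉r  = Q.reflexive i (Q.Eq.reflexive i (cong (val p i) (unique⇒irrelevant (unique (dom p)) _ i∈p)))

      amalgam≼r : _≼_ Q amalgam r
      amalgam≼r i i∈r = let i∈ = ∪⁺ (dom r) (dom p) (inj₁ i∈r) in i∈ , value≤r i i∈ i∈r

      amalgam≼p : _≼_ Q amalgam p
      amalgam≼p i i∈p = let i∈ = ∪⁺ (dom r) (dom p) (inj₂ i∈p) in i∈ , value≤p i i∈ i∈p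

    -- Boxes of conditions with domains of fixed size.

    Box : (S : ∀ i → M → Pred (Q.Carrier i) ℓ) → (I → M) → ℕ → Pred (Condition Q) ℓ
    Box S h n p = length (list (dom p)) ≡ n × boxProduct Q S (dom p) (λ i _ → h i) (val p)

    -- The common size `n` bounds the domains, as the weak Δ-system requires; `linked` is then
    -- applied at its root only.
    box-FrLinked : ∀ (S : ∀ i → M → Pred (Q.Carrier i) ℓ) h n →
                   (∀ u → FrLinked (finiteProduct Q u) (boxProduct Q S u (λ i _ → h i))) →
                   FrLinked (finiteSupportProduct Q) (Box S h n)
    box-FrLinked S h n linked p̄ p̄∈ = q , InfinitelyOften⇒⊩infinite (finiteSupportProduct Q) em {q} {p̄} often
      where
      open WeakΔSystem (weakΔSystem (dom ∘ p̄) n (λ k → ≤-reflexive (proj₁ (p̄∈ k))))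
        renaming (subsequence to g)

      restricted : ℕ → Π Q root
      restricted k i i∈u = val (p̄ (g k)) i (root⊆ k i∈u)

      linkedᵤ = linked root restricted (λ k i i∈u → proj₂ (p̄∈ (g k)) i (root⊆ k i∈u))

      q : Condition Q
      q = record { dom = root ; val = proj₁ linkedᵤ }

      -- Take the maximum of the thresholds that `sparse` gives for the finitely many points.
      avoid : ∀ is → ∃[ m ] (∀ k → m ≤ k → ∀ {i} → i ∈ is → i ∈ᶠ dom (p̄ (g k)) → i ∈ᶠ root)
      avoid []       = 0 , λ _ _ ()
      avoid (i ∷ is) with m , av ← avoid is with em {P = i ∈ᶠ root}
      ... | yes i∈u = m , λ { k m≤k (here refl) _ → i∈u ; k m≤k (there i∈is) → av k m≤k i∈is }
      ... | no i∉u with m′ , sp ← sparse i∉u = m ⊔ m′ , λ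
        { k le (here refl)  i∈ → ⊥-elim (sp k (≤-trans (m≤n⊔m m m′) le) i∈)
        ; k le (there i∈is) → av k (≤-trans (m≤m⊔n m m′) le) i∈is }

      often : InfinitelyOften (finiteSupportProduct Q) q p̄
      often m r r≼q = amalgam , amalgam≼r , g k , <-≤-trans (≤-trans (s≤s (m≤m⊔n m m′)) m⊔m′<k) (cofinal k) , amalgam≼p
        where
        av = avoid (list (dom r))
        m′ = proj₁ av

        -- An index above m ⊔ m′ is both large enough for m and past the threshold that keeps
        -- `dom r` off the new domain outside the root.
        found = ⊩infinite⇒InfinitelyOften (finiteProduct Q root) em (proj₂ linkedᵤ) (m ⊔ m′)
                  (λ i i∈u → val r i (proj₁ (r≼q i i∈u))) (λ i i∈u → proj₂ (r≼q i i∈u))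
        t = proj₁ found
        k = proj₁ (proj₂ (proj₂ found))
        m⊔m′<k = proj₁ (proj₂ (proj₂ (proj₂ found)))

        open Amalgamation root r (p̄ (g k)) t
          (λ i i∈u i∈r → subst (λ z → Q._≤_ i (t i i∈u) (val r i z))
            (unique⇒irrelevant (unique (dom r)) _ i∈r) (proj₁ (proj₂ found) i i∈u))
          (λ i i∈u i∈p → subst (λ z → Q._≤_ i (t i i∈u) (val (p̄ (g k)) i z))
            (unique⇒irrelevant (unique (dom (p̄ (g k)))) _ i∈p) (proj₂ (proj₂ (proj₂ (proj₂ found))) i i∈u))
          (λ i i∈r i∈p → proj₂ av k (≤-trans (m≤n⊔m m m′) (<⇒≤ m⊔m′<k)) i∈r i∈p)

  -- The cover indexed by `M`.

  module _ {M I : Set ℓ} (Q : I → Poset ℓ ℓ ℓ) (S : ∀ i → M → Pred (Poset.Carrier (Q i)) ℓ)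
           (β : I ↣ (M → Bool)) (index : (DecisionTree M × ℕ) ↣ M) where
    open Condition

    piece : M → Pred (Condition Q) ℓ
    piece ζ p = ∃[ t ] ∃[ n ] (Injection.to index (t , n) ≡ ζ × Box Q S (evalAt β t) n p)

    piece-covers : M → (∀ i → Covers (Q i) (S i)) → Covers (finiteSupportProduct Q) piece
    piece-covers ζ covers p =
      let t , t≗ = interpolate β ζ (unique (dom p)) (λ i i∈ → proj₁ (covers i (val p i i∈)))
      in  Injection.to index (t , length (list (dom p))) , t , length (list (dom p)) , refl , refl ,
          λ i i∈ → subst (λ ζ → S i ζ (val p i i∈)) (sym (t≗ i i∈)) (proj₂ (covers i (val p i i∈)))

    piece-FrLinked : (∀ u s → FrLinked (finiteProduct Q u) (boxProduct Q S u s)) →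
                     ∀ ζ → FrLinked (finiteSupportProduct Q) (piece ζ)
    piece-FrLinked linked ζ p̄ p̄∈ = box-FrLinked Q S (evalAt β t) n (λ u → linked u (λ i _ → evalAt β t i)) p̄ same-box
      where
      -- Each term comes with its own tree and size; injectivity of `index` identifies them with
      -- those of `p̄ 0`.
      t = proj₁ (p̄∈ 0)
      n = proj₁ (proj₂ (p̄∈ 0))

      same-box : ∀ k → Box Q S (evalAt β t) n (p̄ k)
      same-box k =
        let t′ , n′ , eq , box = p̄∈ k
            _ , _ , eq₀ , _ = p̄∈ 0
        in  subst (λ (t , n) → Box Q S (evalAt β t) n (p̄ k)) (Injection.injective index (trans eq (sym eq₀))) box

theorem3p22 : (∀ {a} → ExcludedMiddle a) →
    (∀ {a b} → Extensionality a b) →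
    ∀ {ℓ} (M : Set ℓ) → ℕ ↣ M →
    (I : Set ℓ) (Q : I → Poset ℓ ℓ ℓ)
    (S : ∀ i → M → Pred (Poset.Carrier (Q i)) ℓ) →
    (∀ i → Covers (Q i) (S i)) →
    (∀ i ζ → FrLinked (Q i) (S i ζ)) →
    I ↣ (M → Bool) →
    (∀ (u : FinSubset I) (s : ∀ i → i ∈ᶠ u → M) → FrLinked (finiteProduct Q u) (boxProduct Q S u s)) →
    M -FrLinked (finiteSupportProduct Q)
theorem3p22 em ext M ι I Q S covers _ β linked =
  -- `Injection.to ι 0` provides the default leaf for interpolation.
  piece Q S β index , piece-covers Q S β index (Injection.to ι 0) covers , piece-FrLinked Q S β index linked
  where
  open Proof em ext

  index : (DecisionTree M × ℕ) ↣ M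
  index = code ι (Classical.Cardinality.×-↣ em ext ι)
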